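{- For every finite simple graph $G$ on $n$ vertices, $\alpha_{1}(G) + \tau_{B}(G) \le \frac{3 n^2}{10}$.
   Context: All graphs are finite, simple and undirected. A triangle-independent set in $G$ is a set of edges containing at most one edge from each triangle of $G$; $\alpha_{1}(G)$ denotes the maximum size of a triangle-independent set in $G$. $\tau_{B}(G)$ denotes the minimum size of a set of edges whose deletion from $G$ leaves a bipartite graph. -}

module Defs where

open import Data.Nat using (ℕ; _+_; _<_; _≤_)
open import Data.Nat.Properties using (_<?_)
open import Data.Bool using (Bool; true; false; _∧_; if_then_else_)
open import Data.Fin using (Fin; toℕ)
open import Data.List using (List; map; allFin)
open import Data.Nat.ListAction using (sum)
open import Data.Product using (Σ; ∃; _×_; _,_)
open import Data.Empty using (⊥)
open import Relation.Nullary.Decidable using (⌊_⌋)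
open import Relation.Binary.PropositionalEquality using (_≡_)

record Graph (n : ℕ) : Set where
  field
    adj   : Fin n → Fin n → Bool
    sym   : ∀ i j → adj i j ≡ adj j i
    irrefl : ∀ i → adj i i ≡ false
open Graph public

record EdgeSet {n : ℕ} (G : Graph n) : Set where
  field
    mem    : Fin n → Fin n → Bool
    memSym : ∀ i j → mem i j ≡ mem j i
    sub    : ∀ i j → mem i j ≡ true → adj G i j ≡ true
open EdgeSet public

size : {n : ℕ} {G : Graph n} → EdgeSet G → ℕ
size {n} S = sum (map (λ i → sum (map (λ j →
  if ⌊ toℕ i <? toℕ j ⌋ ∧ mem S i j then 1 else 0) (allFin n))) (allFin n))

-- Triangle-independent: at most one edge of every triangle of G lies in S.
-- (Quantifying over all ordered triples covers every pair of edges of a triangle.)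
TriangleIndependent : {n : ℕ} {G : Graph n} → EdgeSet G → Set
TriangleIndependent {n} {G} S = ∀ (i j k : Fin n) →
  adj G i j ≡ true → adj G j k ≡ true → adj G i k ≡ true →
  mem S i j ≡ true → mem S j k ≡ true → ⊥

BipartiteAfterDeleting : {n : ℕ} {G : Graph n} → EdgeSet G → Set
BipartiteAfterDeleting {n} {G} D = Σ (Fin n → Bool) λ c → ∀ (i j : Fin n) →
  adj G i j ≡ true → mem D i j ≡ false → c i ≡ c j → ⊥

IsAlpha1 : {n : ℕ} → Graph n → ℕ → Set
IsAlpha1 G k =
  (Σ (EdgeSet G) λ S → TriangleIndependent S × size S ≡ k) ×
  (∀ (S : EdgeSet G) → TriangleIndependent S → size S ≤ k)

IsTauB : {n : ℕ} → Graph n → ℕ → Set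
IsTauB G t =
  (Σ (EdgeSet G) λ D → BipartiteAfterDeleting D × size D ≡ t) ×
  (∀ (D : EdgeSet G) → BipartiteAfterDeleting D → t ≤ size D)

{-# OPTIONS --safe #-}
-- Let S be triangle-independent and write x(u), y(u) for the degrees of u in S and in G.  Some
-- colouring c makes 10 (|S| + #monochromatic edges of c) ≤ 3 n², by induction on n.  If a vertex has
-- 10 x + 5 y ≤ 6 n - 3, delete it and afterwards give it the colour that is rarer among its
-- neighbours.  Otherwise, since the S-neighbours of a vertex are independent in G, every S-edge uv
-- has y(u) + x(v) ≤ n, and this confines each pair (x(u), y(u)) to a small triangle.  For a vertex v,
-- colour the S-neighbours of v true and every other vertex true with a fixed probability p; averaged
-- over v, the expected number of monochromatic edges is a sum over u of a polynomial in x(u), y(u),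
-- which is bounded on that triangle once a multiple of Σ x (n - x - y) ≥ 0 has been added.
module Submission where

open import Defs hiding (sym)
open import Data.Bool using (Bool; true; false; if_then_else_; _∧_; _xor_; not)
import Data.Bool.Properties as Bool
open import Data.Empty using (⊥)
open import Data.Fin using (Fin; zero; suc; punchIn; toℕ)
open import Data.Fin.Properties using (any?; toℕ-injective)
open import Data.Integer using (ℤ; -_; -[1+_]; -1ℤ; 0ℤ; 1ℤ; positive; nonNegative; +≤+; +<+; _≤?_; _<?_)
open import Data.Integer.Properties
open import Data.Integer.Tactic.RingSolver using (solve-∀)
open import Data.List using (map; allFin; tabulate)
open import Data.List.Properties using (map-tabulate)
open import Data.Nat as ℕ using (ℕ; zero; suc)
import Data.Nat.ListAction as List
import Data.Nat.Properties as ℕ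
open import Data.Product using (∃; _×_; _,_; proj₁; proj₂)
open import Data.Sum using (inj₁; inj₂)
open import Data.Vec.Functional using (_∷_; insertAt)
open import Data.Vec.Functional.Properties using (insertAt-lookup; insertAt-punchIn)
open import Function using (_∘_; id)
open import Relation.Binary.PropositionalEquality
open import Relation.Nullary using (Dec; yes; no; contradiction)
open import Relation.Nullary.Decidable using (⌊_⌋; _×-dec_; _→-dec_; ¬?; from-yes)

open import Algebra.Properties.Semiring.Sum +-*-semiring
  using (∑-distrib-+; ∑-comm; *-distribˡ-sum; *-distribʳ-sum; sum-remove)
  renaming (sum to ∑; sum-cong-≗ to ∑-cong)

-- Inequalities and finite sums over the integers.

module _ where
  open import Data.Integer using (+_; _+_; _*_; _-_; _≤_; _<_)

  -- Polynomial inequalities are proved by certificates: `e` is a sum of products of nonnegative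
  -- terms, and the ring solver checks that it equals the difference of the two sides.
  ≤-slack : ∀ {i j} e → 0ℤ ≤ e → j - i ≡ e → i ≤ j
  ≤-slack e 0≤e eq = 0≤i-j⇒j≤i (subst (0ℤ ≤_) (sym eq) 0≤e)

  slack : ∀ {i j} → i ≤ j → 0ℤ ≤ j - i
  slack = i≤j⇒0≤j-i

  infixl 7 _*⁺_
  infixl 6 _+⁺_

  _+⁺_ : ∀ {i j} → 0ℤ ≤ i → 0ℤ ≤ j → 0ℤ ≤ i + j
  _+⁺_ = +-mono-≤

  _*⁺_ : ∀ {i j} → 0ℤ ≤ i → 0ℤ ≤ j → 0ℤ ≤ i * j
  _*⁺_ {i} {j} 0≤i 0≤j = subst (_≤ i * j) (*-zeroʳ i) (*-monoˡ-≤-nonNeg i {{nonNegative 0≤i}} 0≤j)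

  nonneg : ∀ n → 0ℤ ≤ + n
  nonneg n = +≤+ ℕ.z≤n

  ∑-linear : ∀ {n} (f g : Fin n → ℤ) x → ∑ (λ i → f i + x * g i) ≡ ∑ f + x * ∑ g
  ∑-linear f g x = trans (∑-distrib-+ f (λ i → x * g i)) (cong (_+_ (∑ f)) (sym (*-distribˡ-sum x g)))

  ∑-mono : ∀ {n} {f g : Fin n → ℤ} → (∀ i → f i ≤ g i) → ∑ f ≤ ∑ g
  ∑-mono {zero}  f≤g = ≤-refl
  ∑-mono {suc n} f≤g = +-mono-≤ (f≤g zero) (∑-mono (f≤g ∘ suc))

  ∑-const : ∀ n x → ∑ {n} (λ _ → x) ≡ + n * x
  ∑-const zero    x = refl
  ∑-const (suc n) x = trans (cong (_+_ x) (∑-const n x)) (sym (suc-* (+ n) x))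

  ∑-nonneg : ∀ {n} {f : Fin n → ℤ} → (∀ i → 0ℤ ≤ f i) → 0ℤ ≤ ∑ f
  ∑-nonneg {zero}  0≤f = ≤-refl
  ∑-nonneg {suc n} 0≤f = 0≤f zero +⁺ ∑-nonneg (0≤f ∘ suc)

  ∑∑ : ∀ {n} → (Fin n → Fin n → ℤ) → ℤ
  ∑∑ F = ∑ λ i → ∑ (F i)

  ∑∑-cong : ∀ {n} {F G : Fin n → Fin n → ℤ} → (∀ i j → F i j ≡ G i j) → ∑∑ F ≡ ∑∑ G
  ∑∑-cong F≗G = ∑-cong λ i → ∑-cong (F≗G i)

  ∑∑-linear : ∀ {n} (F G : Fin n → Fin n → ℤ) x → ∑∑ (λ i j → F i j + x * G i j) ≡ ∑∑ F + x * ∑∑ G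
  ∑∑-linear F G x = trans (∑-cong λ i → ∑-linear (F i) (G i) x) (∑-linear (λ i → ∑ (F i)) (λ i → ∑ (G i)) x)

  ∑∑-scale : ∀ {n} x (F : Fin n → Fin n → ℤ) → ∑∑ (λ i j → x * F i j) ≡ x * ∑∑ F
  ∑∑-scale x F = sym (trans (*-distribˡ-sum x (λ i → ∑ (F i))) (∑-cong λ i → *-distribˡ-sum x (F i)))

  -- If the first value exceeds `m`, dropping it leaves values whose average is still at most `m`.
  ∃-≤-average : ∀ {n} (f : Fin (suc n) → ℤ) m → ∑ f ≤ + suc n * m → ∃ λ i → f i ≤ m
  ∃-≤-average f m ∑f≤ with f zero ≤? m
  ... | yes f₀≤m = zero , f₀≤m
  ∃-≤-average {zero} f m ∑f≤ | no f₀≰m =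
    contradiction (subst₂ _≤_ (+-identityʳ (f zero)) (*-identityˡ m) ∑f≤) f₀≰m
  ∃-≤-average {suc n} f m ∑f≤ | no f₀≰m =
    let i , fᵢ≤m = ∃-≤-average (f ∘ suc) m
          (≤-slack _ (slack ∑f≤ +⁺ slack (<⇒≤ (≰⇒> f₀≰m))) (identity (f zero) (∑ (f ∘ suc)) (+ suc n) m))
    in suc i , fᵢ≤m
    where
    identity : ∀ f₀ r k m → k * m - r ≡ (1ℤ + k) * m - (f₀ + r) + (f₀ - m)
    identity = solve-∀

  -- Symmetric matrices with zero diagonal.

  Symmetric : ∀ {n} → (Fin n → Fin n → ℤ) → Set
  Symmetric W = ∀ i j → W i j ≡ W j i

  Hollow : ∀ {n} → (Fin n → Fin n → ℤ) → Set
  Hollow W = ∀ i → W i i ≡ 0ℤ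

  ∑-hollow : ∀ {n} (F : Fin (suc n) → Fin (suc n) → ℤ) → Hollow F → ∀ u →
    ∑ (F u) ≡ ∑ λ j → F u (punchIn u j)
  ∑-hollow F hollow u = trans (sum-remove {i = u} (F u))
    (trans (cong (λ z → z + ∑ λ j → F u (punchIn u j)) (hollow u)) (+-identityˡ _))

  -- Row `u` and column `u` agree by symmetry, which gives the factor 2, and their common entry is
  -- zero.
  ∑∑-remove : ∀ {n} (F : Fin (suc n) → Fin (suc n) → ℤ) → Symmetric F → Hollow F → ∀ u →
    ∑∑ F ≡ ∑∑ (λ i j → F (punchIn u i) (punchIn u j)) + + 2 * ∑ λ j → F u (punchIn u j)
  ∑∑-remove F symm hollow u = begin
    ∑∑ F
      ≡⟨ sum-remove {i = u} (λ i → ∑ (F i)) ⟩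
    ∑ (F u) + ∑ (λ i → ∑ (F (punchIn u i)))
      ≡⟨ cong₂ _+_ (trans (sum-remove {i = u} (F u)) (cong (_+ r) (hollow u)))
           (∑-cong λ i → trans (sum-remove {i = u} (F (punchIn u i)))
             (cong (_+ ∑ (λ j → F (punchIn u i) (punchIn u j))) (symm _ u))) ⟩
    (0ℤ + r) + ∑ (λ i → F u (punchIn u i) + ∑ (λ j → F (punchIn u i) (punchIn u j)))
      ≡⟨ cong (_+_ (0ℤ + r)) (∑-distrib-+ (λ i → F u (punchIn u i)) _) ⟩
    (0ℤ + r) + (r + ∑∑ (λ i j → F (punchIn u i) (punchIn u j)))
      ≡⟨ collect r _ ⟩
    ∑∑ (λ i j → F (punchIn u i) (punchIn u j)) + + 2 * r ∎
    where
    open ≡-Reasoning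
    r = ∑ λ j → F u (punchIn u j)
    collect : ∀ r z → 0ℤ + r + (r + z) ≡ z + + 2 * r
    collect = solve-∀

  -- Spin energies and rounding.

  -- The linear term h is what lets the rounding below go by induction on n: fixing the spin of one
  -- vertex turns its interactions into a change of h.
  energy : ∀ {n} → (Fin n → Fin n → ℤ) → (Fin n → ℤ) → (Fin n → ℤ) → ℤ
  energy W h s = ∑ λ i → s i * (+ 2 * h i + ∑ λ j → W i j * s j)

  spin : ℤ → Bool → ℤ
  spin q b = if b then q else - q

  energy-field : ∀ {n} W (h k s : Fin n → ℤ) x →
    energy W (λ i → h i + x * k i) s ≡ energy W h s + + 2 * x * ∑ λ i → k i * s i
  energy-field W h k s x = begin
    energy W (λ i → h i + x * k i) s
      ≡⟨ ∑-cong (λ i → identity (h i) (k i) (s i) x (∑ λ j → W i j * s j)) ⟩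
    ∑ (λ i → s i * (+ 2 * h i + ∑ λ j → W i j * s j) + + 2 * x * (k i * s i))
      ≡⟨ ∑-linear (λ i → s i * (+ 2 * h i + ∑ λ j → W i j * s j)) (λ i → k i * s i) (+ 2 * x) ⟩
    energy W h s + + 2 * x * ∑ (λ i → k i * s i) ∎
    where
    open ≡-Reasoning
    identity : ∀ h k s x r →
      s * (+ 2 * (h + x * k) + r) ≡ s * (+ 2 * h + r) + + 2 * x * (k * s)
    identity = solve-∀

  -- The zero diagonal removes the square of `s zero`, so the energy is affine in this spin;
  -- symmetry merges the row and the column of the vertex into a factor 2.
  energy-suc : ∀ {n} W (h s : Fin (suc n) → ℤ) → Symmetric W → Hollow W →
    energy W h s ≡
    energy (λ i j → W (suc i) (suc j)) (h ∘ suc) (s ∘ suc) +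
    + 2 * s zero * (h zero + ∑ λ i → W (suc i) zero * s (suc i))
  energy-suc W h s symm hollow = begin
    s₀ * (+ 2 * h₀ + (W zero zero * s₀ + ∑ λ j → W zero (suc j) * s (suc j)))
      + ∑ (λ i → s (suc i) * (+ 2 * h (suc i) + (W (suc i) zero * s₀ + R i)))
      ≡⟨ cong₂ _+_
           (cong (λ z → s₀ * (+ 2 * h₀ + z))
             (cong₂ (λ w z → w * s₀ + z) (hollow zero) (∑-cong λ j → cong (_* s (suc j)) (symm zero (suc j)))))
           (∑-cong λ i → row (s (suc i)) (h (suc i)) (W (suc i) zero) s₀ (R i)) ⟩
    s₀ * (+ 2 * h₀ + (0ℤ * s₀ + r))
      + ∑ (λ i → s (suc i) * (+ 2 * h (suc i) + R i) + s₀ * (W (suc i) zero * s (suc i)))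
      ≡⟨ cong (_+_ (s₀ * (+ 2 * h₀ + (0ℤ * s₀ + r))))
           (∑-linear (λ i → s (suc i) * (+ 2 * h (suc i) + R i)) (λ i → W (suc i) zero * s (suc i)) s₀) ⟩
    s₀ * (+ 2 * h₀ + (0ℤ * s₀ + r)) + (E + s₀ * r)
      ≡⟨ collect s₀ h₀ r E ⟩
    E + + 2 * s₀ * (h₀ + r) ∎
    where
    open ≡-Reasoning
    s₀ = s zero
    h₀ = h zero
    r = ∑ λ i → W (suc i) zero * s (suc i)
    R = λ i → ∑ λ j → W (suc i) (suc j) * s (suc j)
    E = energy (λ i j → W (suc i) (suc j)) (h ∘ suc) (s ∘ suc)
    row : ∀ s h w s₀ r → s * (+ 2 * h + (w * s₀ + r)) ≡ s * (+ 2 * h + r) + s₀ * (w * s)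
    row = solve-∀
    collect : ∀ s h r e → s * (+ 2 * h + (0ℤ * s + r)) + (e + s * r) ≡ e + + 2 * s * (h + r)
    collect = solve-∀

  -- A linear function on the interval from `- q` to `q` is smallest at an endpoint, selected by the
  -- sign of its slope `g`.
  round-spin : ∀ {q x} → - q ≤ x → x ≤ q → ∀ g → ∃ λ b → spin q b * g ≤ x * g
  round-spin {q} {x} -q≤x x≤q g with ≤-total 0ℤ g
  ... | inj₁ 0≤g = false , ≤-slack _ (slack -q≤x *⁺ 0≤g) (identity q x g)
    where
    identity : ∀ q x g → x * g - - q * g ≡ (x - - q) * g
    identity = solve-∀
  ... | inj₂ g≤0 = true , ≤-slack _ (slack x≤q *⁺ slack g≤0) (identity q x g)
    where
    identity : ∀ q x g → x * g - q * g ≡ (q - x) * (0ℤ - g)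
    identity = solve-∀

  -- Method of conditional expectations: a spin between `- q` and `q` is the mean of a random spin
  -- `± q`. The energy is affine in each spin separately, so moving the spins one after another to a
  -- suitable endpoint never increases it.
  rounding : ∀ {n} q W (h s : Fin n → ℤ) → Symmetric W → Hollow W →
    (∀ i → - q ≤ s i) → (∀ i → s i ≤ q) →
    ∃ λ (c : Fin n → Bool) → energy W h (spin q ∘ c) ≤ energy W h s
  rounding {zero}  q W h s symm hollow lower upper = (λ ()) , ≤-refl
  rounding {suc n} q W h s symm hollow lower upper
    with b , b-good ← round-spin (lower zero) (upper zero) (h zero + ∑ λ i → W (suc i) zero * s (suc i))
    with c , c-good ← rounding q (λ i j → W (suc i) (suc j)) (λ i → h (suc i) + spin q b * W (suc i) zero) (s ∘ suc)
                        (λ i j → symm (suc i) (suc j)) (hollow ∘ suc) (lower ∘ suc) (upper ∘ suc)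
    = b ∷ c , (begin
    energy W h (spin q ∘ (b ∷ c))
      ≡⟨ energy-suc W h (spin q ∘ (b ∷ c)) symm hollow ⟩
    E (spin q ∘ c) + + 2 * spin q b * (h zero + r (spin q ∘ c))
      ≡⟨ shift (spin q ∘ c) ⟩
    energy W′ h′ (spin q ∘ c) + + 2 * spin q b * h zero
      ≤⟨ +-monoˡ-≤ (+ 2 * spin q b * h zero) c-good ⟩
    energy W′ h′ (s ∘ suc) + + 2 * spin q b * h zero
      ≡⟨ shift (s ∘ suc) ⟨
    E (s ∘ suc) + + 2 * spin q b * (h zero + r (s ∘ suc))
      -- The bound for the first spin enters twice because its slope carries the factor 2.
      ≤⟨ ≤-slack _ (slack b-good +⁺ slack b-good) (double (spin q b) (s zero) (h zero + r (s ∘ suc)) (E (s ∘ suc))) ⟩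
    E (s ∘ suc) + + 2 * s zero * (h zero + r (s ∘ suc))
      ≡⟨ energy-suc W h s symm hollow ⟨
    energy W h s ∎)
    where
    open ≤-Reasoning
    W′ = λ i j → W (suc i) (suc j)
    h′ = λ i → h (suc i) + spin q b * W (suc i) zero
    E = energy W′ (h ∘ suc)
    r : (Fin n → ℤ) → ℤ
    r t = ∑ λ i → W (suc i) zero * t i
    distribute : ∀ e x h r → e + + 2 * x * (h + r) ≡ e + + 2 * x * r + + 2 * x * h
    distribute = solve-∀
    shift : ∀ t → E t + + 2 * spin q b * (h zero + r t) ≡ energy W′ h′ t + + 2 * spin q b * h zero
    shift t = trans (distribute (E t) (spin q b) (h zero) (r t))
      (cong (λ z → z + + 2 * spin q b * h zero) (sym (energy-field W′ (h ∘ suc) (λ i → W (suc i) zero) t (spin q b))))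
    double : ∀ y x g e → e + + 2 * x * g - (e + + 2 * y * g) ≡ (x * g - y * g) + (x * g - y * g)
    double = solve-∀

  energy-quadratic : ∀ {n} W (s : Fin n → ℤ) → energy W (λ _ → 0ℤ) s ≡ ∑∑ λ i j → W i j * (s i * s j)
  energy-quadratic W s = ∑-cong λ i → begin
    s i * (+ 2 * 0ℤ + ∑ λ j → W i j * s j)  ≡⟨ cong (s i *_) (+-identityˡ _) ⟩
    s i * ∑ (λ j → W i j * s j)             ≡⟨ *-distribˡ-sum (s i) (λ j → W i j * s j) ⟩
    ∑ (λ j → s i * (W i j * s j))           ≡⟨ ∑-cong (λ j → identity (s i) (W i j) (s j)) ⟩
    ∑ (λ j → W i j * (s i * s j))           ∎
    where
    open ≡-Reasoning
    identity : ∀ x w y → x * (w * y) ≡ w * (x * y)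
    identity = solve-∀

  -- Indicators and the monochromatic edges of a colouring.

  ⟦_⟧ : Bool → ℤ
  ⟦ b ⟧ = if b then 1ℤ else 0ℤ

  ⟦⟧-nonneg : ∀ b → 0ℤ ≤ ⟦ b ⟧
  ⟦⟧-nonneg true  = +≤+ ℕ.z≤n
  ⟦⟧-nonneg false = ≤-refl

  ⟦⟧≤1 : ∀ b → ⟦ b ⟧ ≤ 1ℤ
  ⟦⟧≤1 true  = ≤-refl
  ⟦⟧≤1 false = +≤+ ℕ.z≤n

  monochromatic : ∀ {n} → Graph n → (Fin n → Bool) → Fin n → Fin n → Bool
  monochromatic G c i j = adj G i j ∧ not (c i xor c j)

  module _ {n} (G : Graph n) (c : Fin n → Bool) where

    monochromatic-edges : EdgeSet G
    monochromatic-edges .mem = monochromatic G c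
    monochromatic-edges .memSym i j =
      cong₂ _∧_ (Graph.sym G i j) (cong not (Bool.xor-comm (c i) (c j)))
    monochromatic-edges .sub i j = Bool.∧-conicalˡ (adj G i j) (not (c i xor c j))

    monochromatic-edges-bipartite : BipartiteAfterDeleting monochromatic-edges
    monochromatic-edges-bipartite = c , λ i j edge kept cᵢ≡cⱼ →
      contradiction (trans (sym (forced edge cᵢ≡cⱼ)) kept) λ ()
      where
      forced : ∀ {e b b′} → e ≡ true → b ≡ b′ → e ∧ not (b xor b′) ≡ true
      forced {b = true}  refl refl = refl
      forced {b = false} refl refl = refl

  module _ {n} (G : Graph n) where

    A : Fin n → Fin n → ℤ
    A i j = ⟦ adj G i j ⟧

    A-symmetric : Symmetric A
    A-symmetric i j = cong ⟦_⟧ (Graph.sym G i j)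

    A-hollow : Hollow A
    A-hollow i = cong ⟦_⟧ (irrefl G i)

    degree : Fin n → ℤ
    degree i = ∑ (A i)

    Mono : (Fin n → Bool) → Fin n → Fin n → ℤ
    Mono c i j = ⟦ monochromatic G c i j ⟧

    -- On an edge the product of the end spins is `q * q` if the ends agree and its negative
    -- otherwise, so adding `q * q` gives twice `q * q` times the indicator of a monochromatic edge.
    Mono-energy : ∀ q c →
      + 2 * (q * q) * ∑∑ (Mono c) ≡
      q * q * ∑∑ A + energy A (λ _ → 0ℤ) (spin q ∘ c)
    Mono-energy q c = begin
      + 2 * (q * q) * ∑∑ (Mono c)
        ≡⟨ ∑∑-scale (+ 2 * (q * q)) (Mono c) ⟨
      ∑∑ (λ i j → + 2 * (q * q) * ⟦ monochromatic G c i j ⟧)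
        ≡⟨ ∑∑-cong (λ i j → pointwise (adj G i j) (c i) (c j)) ⟩
      ∑∑ (λ i j → A i j * (spin q (c i) * spin q (c j)) + q * q * A i j)
        ≡⟨ ∑∑-linear (λ i j → A i j * (spin q (c i) * spin q (c j))) A (q * q) ⟩
      ∑∑ (λ i j → A i j * (spin q (c i) * spin q (c j))) + q * q * ∑∑ A
        ≡⟨ cong (_+ q * q * ∑∑ A) (energy-quadratic A (spin q ∘ c)) ⟨
      energy A (λ _ → 0ℤ) (spin q ∘ c) + q * q * ∑∑ A
        ≡⟨ +-comm (energy A (λ _ → 0ℤ) (spin q ∘ c)) (q * q * ∑∑ A) ⟩
      q * q * ∑∑ A + energy A (λ _ → 0ℤ) (spin q ∘ c) ∎
      where
      open ≡-Reasoning
      non-edge : ∀ q x y → + 2 * (q * q) * 0ℤ ≡ 0ℤ * (x * y) + q * q * 0ℤ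
      non-edge = solve-∀
      both-true : ∀ q → + 2 * (q * q) * 1ℤ ≡ 1ℤ * (q * q) + q * q * 1ℤ
      both-true = solve-∀
      both-false : ∀ q → + 2 * (q * q) * 1ℤ ≡ 1ℤ * (- q * - q) + q * q * 1ℤ
      both-false = solve-∀
      left-true : ∀ q → + 2 * (q * q) * 0ℤ ≡ 1ℤ * (q * - q) + q * q * 1ℤ
      left-true = solve-∀
      right-true : ∀ q → + 2 * (q * q) * 0ℤ ≡ 1ℤ * (- q * q) + q * q * 1ℤ
      right-true = solve-∀
      pointwise : ∀ e b b′ → + 2 * (q * q) * ⟦ e ∧ not (b xor b′) ⟧ ≡
                             ⟦ e ⟧ * (spin q b * spin q b′) + q * q * ⟦ e ⟧
      pointwise false b     b′    = non-edge q (spin q b) (spin q b′)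
      pointwise true  true  true  = both-true q
      pointwise true  true  false = left-true q
      pointwise true  false true  = right-true q
      pointwise true  false false = both-false q

  degree<order : ∀ {n} (G : Graph (suc n)) u → degree G u < + suc n
  degree<order {n} G u = ≤-<-trans (begin
    degree G u                          ≡⟨ ∑-hollow (A G) (A-hollow G) u ⟩
    ∑ (λ j → A G u (punchIn u j))       ≤⟨ ∑-mono (λ j → ⟦⟧≤1 (adj G u (punchIn u j))) ⟩
    ∑ {n} (λ _ → 1ℤ)                    ≡⟨ trans (∑-const n 1ℤ) (*-identityʳ (+ n)) ⟩
    + n                                 ∎) (Data.Integer.+<+ ℕ.≤-refl)
    where open ≤-Reasoning

  -- Edge sets as matrices, and their degrees.

  ∑-tabulate : ∀ {n} (f : Fin n → ℕ) → + List.sum (tabulate f) ≡ ∑ (λ i → + f i)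
  ∑-tabulate {zero}  f = refl
  ∑-tabulate {suc n} f = cong (_+_ (+ f zero)) (∑-tabulate (f ∘ suc))

  ∑-allFin : ∀ {n} (f : Fin n → ℕ) → + List.sum (map f (allFin n)) ≡ ∑ (λ i → + f i)
  ∑-allFin f = trans (cong (+_ ∘ List.sum) (map-tabulate id f)) (∑-tabulate f)

  module _ {n} {G : Graph n} (S : EdgeSet G) where

    M : Fin n → Fin n → ℤ
    M i j = ⟦ mem S i j ⟧

    M-symmetric : Symmetric M
    M-symmetric i j = cong ⟦_⟧ (memSym S i j)

    S-degree : Fin n → ℤ
    S-degree i = ∑ (M i)

    M-hollow : Hollow M
    M-hollow i with mem S i i in ii
    ... | false = refl
    ... | true with () ← trans (sym (irrefl G i)) (sub S i i ii)

    -- For triangle-independent `S` this is the number of edges of `G` that meet the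
    -- `S`-neighbourhood of `v`, since no edge has both ends there.
    star-weight : Fin n → ℤ
    star-weight v = ∑ λ u → M v u * degree G u

    S-degree≤degree : ∀ u → S-degree u ≤ degree G u
    S-degree≤degree u = ∑-mono λ v → entry (sub S u v)
      where
      entry : ∀ {b e} → (b ≡ true → e ≡ true) → ⟦ b ⟧ ≤ ⟦ e ⟧
      entry {false} {e} _   = ⟦⟧-nonneg e
      entry {true}  {e} b⇒e = ≤-reflexive (cong ⟦_⟧ (sym (b⇒e refl)))

    S-neighbour : ∀ u → 0ℤ < S-degree u → ∃ λ v → mem S u v ≡ true
    S-neighbour u 0<x with any? (λ v → mem S u v Bool.≟ true)
    ... | yes nbr = nbr
    ... | no ¬nbr = contradiction (subst (0ℤ <_) x≡0 0<x) (<-irrefl refl)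
      where
      x≡0 : S-degree u ≡ 0ℤ
      x≡0 = trans (∑-cong λ v → cong ⟦_⟧ (Bool.¬-not λ e → ¬nbr (v , e))) (trans (∑-const n 0ℤ) (*-zeroʳ (+ n)))

    -- `size` counts an edge only at the pair with `i < j`. Adding the transpose restores all
    -- ordered pairs, and the diagonal contributes nothing.
    double-size : + 2 * + size S ≡ ∑∑ (M)
    double-size = begin
      + 2 * + size S                                ≡⟨ cong (+ 2 *_) size≡ ⟩
      + 2 * ∑∑ U                                    ≡⟨ identity (∑∑ U) ⟩
      ∑∑ U + 1ℤ * ∑∑ U                              ≡⟨ cong (λ z → ∑∑ U + 1ℤ * z) (∑-comm U) ⟩
      ∑∑ U + 1ℤ * ∑∑ (λ i j → U j i)                ≡⟨ ∑∑-linear U (λ i j → U j i) 1ℤ ⟨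
      ∑∑ (λ i j → U i j + 1ℤ * U j i)               ≡⟨ ∑∑-cong pointwise ⟩
      ∑∑ (M)                                   ∎
      where
      open ≡-Reasoning
      U : Fin n → Fin n → ℤ
      U i j = ⟦ ⌊ toℕ i ℕ.<? toℕ j ⌋ ∧ mem S i j ⟧
      identity : ∀ z → + 2 * z ≡ z + 1ℤ * z
      identity = solve-∀
      indicator : ∀ b → + (if b then 1 else 0) ≡ ⟦ b ⟧
      indicator true  = refl
      indicator false = refl
      entry : Fin n → Fin n → ℕ
      entry i j = if ⌊ toℕ i ℕ.<? toℕ j ⌋ ∧ mem S i j then 1 else 0
      size≡ : + size S ≡ ∑∑ U
      size≡ = trans (∑-allFin (λ i → List.sum (map (entry i) (allFin n)))) (∑-cong λ i →
        trans (∑-allFin (entry i)) (∑-cong λ j → indicator (⌊ toℕ i ℕ.<? toℕ j ⌋ ∧ mem S i j)))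
      pointwise : ∀ i j → U i j + 1ℤ * U j i ≡ M i j
      pointwise i j with toℕ i ℕ.<? toℕ j | toℕ j ℕ.<? toℕ i
      ... | yes i<j | yes j<i = contradiction j<i (ℕ.<-asym i<j)
      ... | yes _   | no  _   = +-identityʳ (M i j)
      ... | no  _   | yes _   = trans (+-identityˡ _) (trans (*-identityˡ _) (M-symmetric j i))
      ... | no  i≮j | no  j≮i with refl ← toℕ-injective (ℕ.≤-antisym (ℕ.≮⇒≥ j≮i) (ℕ.≮⇒≥ i≮j)) = sym (M-hollow i)

  -- Triangle-independent sets and the cuts around their stars.

  module _ {n} {G : Graph n} (S : EdgeSet G) (independent : TriangleIndependent S) where

    -- An edge `uw` would close a triangle containing the two `S`-edges `uv` and `vw`.
    S-nbrs-independent : ∀ v u w → mem S v u ≡ true → mem S v w ≡ true → adj G u w ≡ true → ⊥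
    S-nbrs-independent v u w vu vw uw =
      independent u v w (sub S u v uv) (sub S v w vw) uw uv vw
      where uv = trans (memSym S u v) vu

    -- A vertex with spin ± q that is positive with probability p = (q + b) / 2q has mean spin b.
    star-energy : ∀ q b v →
      energy (A G) (λ _ → 0ℤ) (λ u → b + (q - b) * M S v u) ≡
      b * b * ∑∑ (A G) + + 2 * b * (q - b) * star-weight S v
    star-energy q b v = begin
      energy (A G) (λ _ → 0ℤ) s
        ≡⟨ energy-quadratic (A G) s ⟩
      ∑∑ (λ u w → A G u w * (s u * s w))
        ≡⟨ ∑∑-cong (λ u w → pointwise (S-nbrs-independent v u w)) ⟩
      ∑∑ (λ u w → b * b * A G u w + b * (q - b) * (M S v u * A G u w) + b * (q - b) * (M S v w * A G u w))
        ≡⟨ ∑∑-linear (λ u w → b * b * A G u w + b * (q - b) * (M S v u * A G u w)) (λ u w → M S v w * A G u w) (b * (q - b)) ⟩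
      ∑∑ (λ u w → b * b * A G u w + b * (q - b) * (M S v u * A G u w)) + b * (q - b) * ∑∑ (λ u w → M S v w * A G u w)
        ≡⟨ cong₂ (λ x y → x + b * (q - b) * y)
             (trans (∑∑-linear (λ u w → b * b * A G u w) (λ u w → M S v u * A G u w) (b * (q - b)))
               (cong₂ (λ x y → x + b * (q - b) * y) (∑∑-scale (b * b) (A G)) row))
             (trans (∑-comm (λ u w → M S v w * A G u w))
               (trans (∑∑-cong λ w u → cong (M S v w *_) (A-symmetric G u w)) row)) ⟩
      b * b * ∑∑ (A G) + b * (q - b) * star-weight S v + b * (q - b) * star-weight S v
        ≡⟨ collect b (q - b) (∑∑ (A G)) (star-weight S v) ⟩
      b * b * ∑∑ (A G) + + 2 * b * (q - b) * star-weight S v ∎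
      where
      open ≡-Reasoning
      s = λ u → b + (q - b) * M S v u
      row : ∑∑ (λ u w → M S v u * A G u w) ≡ star-weight S v
      row = sym (∑-cong λ u → *-distribˡ-sum (M S v u) (A G u))
      collect : ∀ b k d t → b * b * d + b * k * t + b * k * t ≡ b * b * d + + 2 * b * k * t
      collect = solve-∀
      non-edge : ∀ b k x y → 0ℤ * ((b + k * x) * (b + k * y)) ≡ b * b * 0ℤ + b * k * (x * 0ℤ) + b * k * (y * 0ℤ)
      non-edge = solve-∀
      neither : ∀ b k → 1ℤ * ((b + k * 0ℤ) * (b + k * 0ℤ)) ≡ b * b * 1ℤ + b * k * (0ℤ * 1ℤ) + b * k * (0ℤ * 1ℤ)
      neither = solve-∀
      left : ∀ b k → 1ℤ * ((b + k * 1ℤ) * (b + k * 0ℤ)) ≡ b * b * 1ℤ + b * k * (1ℤ * 1ℤ) + b * k * (0ℤ * 1ℤ)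
      left = solve-∀
      right : ∀ b k → 1ℤ * ((b + k * 0ℤ) * (b + k * 1ℤ)) ≡ b * b * 1ℤ + b * k * (0ℤ * 1ℤ) + b * k * (1ℤ * 1ℤ)
      right = solve-∀
      -- Expanding the product leaves one further term, with factor `⟦ x ⟧ * ⟦ y ⟧ * ⟦ e ⟧`; it
      -- vanishes because two `S`-neighbours of `v` are never adjacent.
      pointwise : ∀ {e x y} → (x ≡ true → y ≡ true → e ≡ true → ⊥) →
        ⟦ e ⟧ * ((b + (q - b) * ⟦ x ⟧) * (b + (q - b) * ⟦ y ⟧)) ≡
        b * b * ⟦ e ⟧ + b * (q - b) * (⟦ x ⟧ * ⟦ e ⟧) + b * (q - b) * (⟦ y ⟧ * ⟦ e ⟧)
      pointwise {false} {x}     {y}     _ = non-edge b (q - b) ⟦ x ⟧ ⟦ y ⟧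
      pointwise {true}  {false} {false} _ = neither b (q - b)
      pointwise {true}  {true}  {false} _ = left b (q - b)
      pointwise {true}  {false} {true}  _ = right b (q - b)
      pointwise {true}  {true}  {true}  ¬triangle with () ← ¬triangle refl refl refl

    -- The fractional spins are `q` on the `S`-neighbours of `v` and `b` elsewhere. The right-hand
    -- side is `2 * (q * q)` times the expected number of ordered monochromatic pairs, and rounding
    -- finds a colouring that does no worse.
    star-cut : ∀ {q b} → - q ≤ b → b ≤ q → ∀ v → ∃ λ c →
      + 2 * (q * q) * ∑∑ (Mono G c) ≤
      (q * q + b * b) * ∑∑ (A G) + + 2 * b * (q - b) * star-weight S v
    star-cut {q} {b} -q≤b b≤q v =
      let c , c-good = rounding q (A G) (λ _ → 0ℤ) (λ u → b + (q - b) * M S v u) (A-symmetric G) (A-hollow G)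
                         (λ u → lower (mem S v u)) (λ u → upper (mem S v u))
      in c , (begin
      + 2 * (q * q) * ∑∑ (Mono G c)
        ≡⟨ Mono-energy G q c ⟩
      q * q * ∑∑ (A G) + energy (A G) (λ _ → 0ℤ) (spin q ∘ c)
        ≤⟨ +-monoʳ-≤ (q * q * ∑∑ (A G)) c-good ⟩
      q * q * ∑∑ (A G) + energy (A G) (λ _ → 0ℤ) (λ u → b + (q - b) * M S v u)
        ≡⟨ cong (_+_ (q * q * ∑∑ (A G))) (star-energy q b v) ⟩
      q * q * ∑∑ (A G) + (b * b * ∑∑ (A G) + + 2 * b * (q - b) * star-weight S v)
        ≡⟨ collect (q * q) (b * b) (∑∑ (A G)) (+ 2 * b * (q - b) * star-weight S v) ⟩
      (q * q + b * b) * ∑∑ (A G) + + 2 * b * (q - b) * star-weight S v ∎)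
      where
      open ≤-Reasoning
      collect : ∀ x y d t → x * d + (y * d + t) ≡ (x + y) * d + t
      collect = solve-∀
      at-true : ∀ q b → b + (q - b) * 1ℤ ≡ q
      at-true = solve-∀
      at-false : ∀ q b → b + (q - b) * 0ℤ ≡ b
      at-false = solve-∀
      lower : ∀ x → - q ≤ b + (q - b) * ⟦ x ⟧
      lower true  = subst (- q ≤_) (sym (at-true q b)) (≤-trans -q≤b b≤q)
      lower false = subst (- q ≤_) (sym (at-false q b)) -q≤b
      upper : ∀ x → b + (q - b) * ⟦ x ⟧ ≤ q
      upper true  = ≤-reflexive (at-true q b)
      upper false = subst (_≤ q) (sym (at-false q b)) b≤q

    -- The `G`-neighbours of `u` and the `S`-neighbours of `v` are disjoint: `u` is itself an
    -- `S`-neighbour of `v`, and these are independent in `G`.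
    degree-sum-bound : ∀ {u v} → mem S u v ≡ true → degree G u + S-degree S v ≤ + n
    degree-sum-bound {u} {v} uv = begin
      degree G u + S-degree S v       ≡⟨ ∑-distrib-+ (A G u) (M S v) ⟨
      ∑ (λ w → A G u w + M S v w)     ≤⟨ ∑-mono (λ w → disjoint (S-nbrs-independent v u w (trans (memSym S v u) uv))) ⟩
      ∑ {n} (λ _ → 1ℤ)              ≡⟨ ∑-const n 1ℤ ⟩
      + n * 1ℤ                      ≡⟨ *-identityʳ (+ n) ⟩
      + n                           ∎
      where
      open ≤-Reasoning
      disjoint : ∀ {x y} → (y ≡ true → x ≡ true → ⊥) → ⟦ x ⟧ + ⟦ y ⟧ ≤ 1ℤ
      disjoint {false} {false} _  = nonneg 1
      disjoint {false} {true}  _  = ≤-refl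
      disjoint {true}  {false} _  = ≤-refl
      disjoint {true}  {true}  ¬xy with () ← ¬xy refl refl

  -- The polynomial inequality at a single vertex.

  Admissible : ℤ → ℤ → ℤ → Set
  Admissible N x y =
    + 6 * N - + 2 ≤ + 10 * x + + 5 * y ×
    + 5 * x + + 10 * y ≤ + 9 * N + + 2 ×
    x ≤ y ×
    y < N

  -- The vertex u contributes the left-hand side to the average over v of the cut bounds with spins q
  -- and b, plus k times the inequality Σ x (N - x - y) ≥ 0.
  Bounded : ℤ × ℤ × ℤ → ℤ → ℤ → ℤ → Set
  Bounded (q , b , k) N x y =
    + 10 * (q * q) * N * x + + 5 * (q * q + b * b) * N * y + + 10 * b * (q - b) * (x * y) + k * (x * (N - x - y)) ≤
    + 6 * (q * q) * (N * N)

  -- The first two conditions say that p lies between 0 and 1, the third permits division by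
  -- `2 * (q * q)`, and the last lets the multiple of the deficit keep its sign.
  Valid : ℤ × ℤ × ℤ → Set
  Valid (q , b , k) = - q ≤ b × b ≤ q × 0ℤ < + 2 * (q * q) × 0ℤ ≤ k

  valid? : ∀ w → Dec (Valid w)
  valid? (q , b , k) = - q ≤? b ×-dec b ≤? q ×-dec 0ℤ <? + 2 * (q * q) ×-dec 0ℤ ≤? k

  -- p = 1/5, which fails only for N = 7 and (x , y) = (1 , 6); there p = 2/9 works.
  generic : ℤ × ℤ × ℤ
  generic = + 5 , -[1+ 2 ] , + 180

  special : ℤ × ℤ × ℤ
  special = + 9 , -[1+ 4 ] , + 648

  -- For `N` below 12 the ranges of `x` and `y` miss no admissible pair, as `x ≤ y < N`; the
  -- statement is then decided by evaluation.
  BoundedBelow12 : ℤ × ℤ × ℤ → ℕ → Set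
  BoundedBelow12 w N = ∀ {x} → x ℕ.< 12 → ∀ {y} → y ℕ.< 12 →
    Admissible (+ N) (+ x) (+ y) → Bounded w (+ N) (+ x) (+ y)

  boundedBelow12? : ∀ w N → Dec (BoundedBelow12 w N)
  boundedBelow12? w N = ℕ.allUpTo? (λ x → ℕ.allUpTo? (λ y →
    (_ ≤? _ ×-dec _ ≤? _ ×-dec _ ≤? _ ×-dec _ <? _) →-dec (_ ≤? _)) 12) 12

  generic-small : ∀ {N} → N ℕ.< 12 → N ≢ 7 → BoundedBelow12 generic N
  generic-small {N} N<12 N≢7 {x} x<12 {y} =
    from-yes (ℕ.allUpTo? (λ N → ¬? (N ℕ.≟ 7) →-dec boundedBelow12? generic N) 12) {N} N<12 N≢7 {x} x<12 {y}

  special-seven : BoundedBelow12 special 7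
  special-seven {x} = from-yes (boundedBelow12? special 7) {x}

  -- The slack is ten times
  --   15 w² + t (4 N - 21 w)   with w = N - 2 x and t = y - x,
  -- and if 21 w ≥ 4 N, bounding t by the second admissibility condition leaves a quadratic in w that
  -- is nonnegative on the interval w ≤ (3 N + 4) / 5 given by the first two conditions when N ≥ 12.
  generic-large : ∀ {N x y} → + 12 ≤ N → Admissible N x y → Bounded generic N x y
  generic-large {N} {x} {y} 12≤N (c₁ , c₂ , x≤y , _) with ≤-total (+ 21 * (N - + 2 * x)) (+ 4 * N)
  ... | inj₁ flat = ≤-slack _
    -- With the multiplier 180 the slack on the line `y = x` is a pure square, which vanishes at
    -- `x = y = N / 2`.
    (nonneg 10 *⁺ (nonneg 15 *⁺ square (N - + 2 * x) +⁺ slack x≤y *⁺ slack flat)) (identity N x y)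
    where
    square : ∀ i → 0ℤ ≤ i * i
    square (+ n) = subst (0ℤ ≤_) (pos-* n n) (nonneg (n ℕ.* n))
    square (-[1+ n ]) = +≤+ ℕ.z≤n
    identity : ∀ N x y →
      + 6 * (+ 5 * + 5) * (N * N) -
      (+ 10 * (+ 5 * + 5) * N * x + + 5 * (+ 5 * + 5 + -[1+ 2 ] * -[1+ 2 ]) * N * y
        + + 10 * -[1+ 2 ] * (+ 5 - -[1+ 2 ]) * (x * y) + + 180 * (x * (N - x - y))) ≡
      + 10 * (+ 15 * ((N - + 2 * x) * (N - + 2 * x)) + (y - x) * (+ 4 * N - + 21 * (N - + 2 * x)))
    identity = solve-∀
  ... | inj₂ steep = *-cancelˡ-≤-pos _ _ (+ 10) (≤-slack _
    (nonneg 10 *⁺ (slack steep *⁺ slack c₂)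
      -- The first factor is (3 / 2) (3 N + 4 - 5 w), which vanishes at the right end of the
      -- interval for w. The value of the quadratic there is the last summand, and it is the source
      -- of the threshold 12.
      +⁺ (nonneg 2 *⁺ slack c₁ +⁺ slack c₂) *⁺ (nonneg 10 *⁺ slack 0≤w +⁺ nonneg 8 *⁺ 0≤N +⁺ nonneg 64)
      +⁺ nonneg 8 *⁺ (slack 12≤N *⁺ (nonneg 3 *⁺ 0≤N +⁺ nonneg 4)))
    (identity N x y))
    where
    0≤N : 0ℤ ≤ N
    0≤N = ≤-trans (nonneg 12) 12≤N
    0≤w : 0ℤ ≤ N - + 2 * x
    0≤w = *-cancelˡ-≤-pos _ _ (+ 21) (≤-trans (nonneg 4 *⁺ 0≤N) steep)
    identity : ∀ N x y →
      + 10 * (+ 6 * (+ 5 * + 5) * (N * N)) -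
      + 10 * (+ 10 * (+ 5 * + 5) * N * x + + 5 * (+ 5 * + 5 + -[1+ 2 ] * -[1+ 2 ]) * N * y
        + + 10 * -[1+ 2 ] * (+ 5 - -[1+ 2 ]) * (x * y) + + 180 * (x * (N - x - y))) ≡
      + 10 * ((+ 21 * (N - + 2 * x) - + 4 * N) * (+ 9 * N + + 2 - (+ 5 * x + + 10 * y)))
      + (+ 2 * (+ 10 * x + + 5 * y - (+ 6 * N - + 2)) + (+ 9 * N + + 2 - (+ 5 * x + + 10 * y)))
        * (+ 10 * (N - + 2 * x - 0ℤ) + + 8 * N + + 64)
      + + 8 * ((N - + 12) * (+ 3 * N + + 4))
    identity = solve-∀

  bounded-small : ∀ {w N} → N ℕ.< 12 → BoundedBelow12 w N →
    ∀ {x y} → 0ℤ ≤ x → Admissible (+ N) x y → Bounded w (+ N) x y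
  bounded-small N<12 check {+ x} {+ y} _ adm@(_ , _ , +≤+ x≤y , +<+ y<N) =
    check (ℕ.≤-<-trans x≤y y<12) y<12 adm
    where y<12 = ℕ.<-trans y<N N<12

  weights : ∀ N → ∃ λ w → Valid w × (∀ {x y} → 0ℤ ≤ x → Admissible (+ N) x y → Bounded w (+ N) x y)
  weights N with 12 ℕ.≤? N | N ℕ.≟ 7
  ... | yes 12≤N | _        = generic , from-yes (valid? generic) , λ _ → generic-large (+≤+ 12≤N)
  ... | no  _    | yes refl = special , from-yes (valid? special) , bounded-small {special} (ℕ.m≤m+n 8 4) special-seven
  ... | no  12≰N | no N≢7   = generic , from-yes (valid? generic) ,
    bounded-small {generic} (ℕ.≰⇒> 12≰N) (generic-small (ℕ.≰⇒> 12≰N) N≢7)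

  -- Averaging over the centre of the star.

  module Averaging {m} {G : Graph (suc m)} (S : EdgeSet G) (ti : TriangleIndependent S) where

    N : ℤ
    N = + suc m

    x y : Fin (suc m) → ℤ
    x = S-degree S
    y = degree G

    -- Sum `N - y u - x v ≥ 0` over all ordered pairs with `uv` in `S`: each vertex `v` occurs `x v`
    -- times as a second entry, so the terms `x v` add up to the sum of squares.
    ∑-deficit : 0ℤ ≤ ∑ λ u → x u * (N - x u - y u)
    ∑-deficit = subst (0ℤ ≤_) eq (∑-nonneg λ u → ∑-nonneg λ v → entry u v)
      where
      open ≡-Reasoning
      entry : ∀ u v → 0ℤ ≤ M S u v * (N - y u) + -1ℤ * (M S u v * x v)
      entry u v with mem S u v in uv
      ... | false = subst (0ℤ ≤_) (identity (N - y u) (x v)) ≤-refl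
        where
        identity : ∀ p q → 0ℤ ≡ 0ℤ * p + -1ℤ * (0ℤ * q)
        identity = solve-∀
      ... | true = subst (0ℤ ≤_) (identity N (y u) (x v)) (slack (degree-sum-bound S ti uv))
        where
        identity : ∀ p q r → p - (q + r) ≡ 1ℤ * (p - q) + -1ℤ * (1ℤ * r)
        identity = solve-∀
      collect : ∀ a b c → a * (b - c) + -1ℤ * (a * a) ≡ a * (b - a - c)
      collect = solve-∀
      eq : ∑∑ (λ u v → M S u v * (N - y u) + -1ℤ * (M S u v * x v)) ≡ ∑ λ u → x u * (N - x u - y u)
      eq = begin
        ∑∑ (λ u v → M S u v * (N - y u) + -1ℤ * (M S u v * x v))
          ≡⟨ ∑∑-linear (λ u v → M S u v * (N - y u)) (λ u v → M S u v * x v) -1ℤ ⟩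
        ∑∑ (λ u v → M S u v * (N - y u)) + -1ℤ * ∑∑ (λ u v → M S u v * x v)
          ≡⟨ cong₂ (λ p q → p + -1ℤ * q)
               (∑-cong λ u → sym (*-distribʳ-sum (N - y u) (M S u)))
               (trans (∑-comm (λ u v → M S u v * x v))
                 (∑-cong λ v → trans (∑-cong λ u → cong (_* x v) (M-symmetric S u v))
                   (sym (*-distribʳ-sum (x v) (M S v))))) ⟩
        ∑ (λ u → x u * (N - y u)) + -1ℤ * ∑ (λ u → x u * x u)
          ≡⟨ ∑-linear (λ u → x u * (N - y u)) (λ u → x u * x u) -1ℤ ⟨
        ∑ (λ u → x u * (N - y u) + -1ℤ * (x u * x u))
          ≡⟨ ∑-cong (λ u → collect (x u) N (y u)) ⟩
        ∑ (λ u → x u * (N - x u - y u)) ∎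

    ∑-star-weight : ∑ (star-weight S) ≡ ∑ λ u → x u * y u
    ∑-star-weight = trans (∑-comm (λ v u → M S v u * y u))
      (∑-cong λ u → trans (∑-cong λ v → cong (_* y u) (M-symmetric S v u)) (sym (*-distribʳ-sum (y u) (M S u))))

    -- Summing the vertex bounds and discarding the nonnegative deficit bounds the average of `Y`
    -- over all centres; a centre not above the average supplies the colouring.
    average-cut : ∀ q b k → Valid (q , b , k) → (∀ u → Bounded (q , b , k) N (x u) (y u)) →
      ∃ λ c → + 5 * (∑∑ (M S) + ∑∑ (Mono G c)) ≤ + 3 * (N * N)
    average-cut q b k (-q≤b , b≤q , 0<2q² , 0≤k) bounded =
      let v , Yv≤ = ∃-≤-average Y (+ 6 * (q * q) * (N * N)) ∑Y≤
          c , c-good = star-cut S ti -q≤b b≤q v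
      in c , *-cancelˡ-≤-pos _ _ (+ 2 * (q * q)) {{positive 0<2q²}}
        (≤-slack _ (slack Yv≤ +⁺ (nonneg 5 *⁺ slack c-good))
          (final q b N X D (∑∑ (Mono G c)) (star-weight S v)))
      where
      X = ∑∑ (M S)
      D = ∑∑ (A G)
      c₁ = + 10 * (q * q) * N
      c₂ = + 5 * (q * q + b * b) * N
      c₃ = + 10 * b * (q - b)
      Y : Fin (suc m) → ℤ
      -- Five times the bound of `star-cut`, plus the share of `X`; hence an upper bound for
      -- `2 * (q * q)` times the quantity to be estimated.
      Y v = + 10 * (q * q) * X + + 5 * (q * q + b * b) * D + c₃ * star-weight S v
      final : ∀ q b N X D m t →
        + 2 * (q * q) * (+ 3 * (N * N)) - + 2 * (q * q) * (+ 5 * (X + m)) ≡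
        (+ 6 * (q * q) * (N * N) - (+ 10 * (q * q) * X + + 5 * (q * q + b * b) * D + + 10 * b * (q - b) * t))
        + + 5 * ((q * q + b * b) * D + + 2 * b * (q - b) * t - + 2 * (q * q) * m)
      final = solve-∀
      xy = λ u → x u * y u
      deficit = λ u → x u * (N - x u - y u)
      total : ∑ (λ u → c₁ * x u + c₂ * y u + c₃ * xy u + k * deficit u) ≡
              c₁ * X + c₂ * D + c₃ * ∑ xy + k * ∑ deficit
      total = begin
        ∑ (λ u → c₁ * x u + c₂ * y u + c₃ * xy u + k * deficit u)
          ≡⟨ ∑-linear (λ u → c₁ * x u + c₂ * y u + c₃ * xy u) deficit k ⟩
        ∑ (λ u → c₁ * x u + c₂ * y u + c₃ * xy u) + k * ∑ deficit
          ≡⟨ cong (_+ k * ∑ deficit) (∑-linear (λ u → c₁ * x u + c₂ * y u) xy c₃) ⟩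
        ∑ (λ u → c₁ * x u + c₂ * y u) + c₃ * ∑ xy + k * ∑ deficit
          ≡⟨ cong (λ z → z + c₃ * ∑ xy + k * ∑ deficit) (∑-linear (λ u → c₁ * x u) y c₂) ⟩
        ∑ (λ u → c₁ * x u) + c₂ * D + c₃ * ∑ xy + k * ∑ deficit
          ≡⟨ cong (λ z → z + c₂ * D + c₃ * ∑ xy + k * ∑ deficit) (*-distribˡ-sum c₁ x) ⟨
        c₁ * X + c₂ * D + c₃ * ∑ xy + k * ∑ deficit ∎
        where open ≡-Reasoning
      ∑Y : ∑ Y ≡ N * (+ 10 * (q * q) * X + + 5 * (q * q + b * b) * D) + c₃ * ∑ xy
      ∑Y = trans (∑-linear (λ _ → + 10 * (q * q) * X + + 5 * (q * q + b * b) * D) (star-weight S) c₃)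
        (cong₂ (λ p r → p + c₃ * r) (∑-const (suc m) (+ 10 * (q * q) * X + + 5 * (q * q + b * b) * D)) ∑-star-weight)
      rearrange : ∀ q b N X D t k e B →
        N * B - (N * (+ 10 * (q * q) * X + + 5 * (q * q + b * b) * D) + + 10 * b * (q - b) * t) ≡
        N * B - (+ 10 * (q * q) * N * X + + 5 * (q * q + b * b) * N * D + + 10 * b * (q - b) * t + k * e) + k * e
      rearrange = solve-∀
      ∑Y≤ : ∑ Y ≤ N * (+ 6 * (q * q) * (N * N))
      ∑Y≤ = subst (_≤ N * (+ 6 * (q * q) * (N * N))) (sym ∑Y)
        (≤-slack _ (slack (subst₂ _≤_ total (∑-const (suc m) (+ 6 * (q * q) * (N * N))) (∑-mono bounded)) +⁺ 0≤k *⁺ ∑-deficit)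
          (rearrange q b N X D (∑ xy) k (∑ deficit) (+ 6 * (q * q) * (N * N))))

    module _ (dense : ∀ u → + 6 * N - + 2 ≤ + 10 * x u + + 5 * y u) where

      -- For `x u = 0` density would require `5 y ≥ 6 N - 2`, but `y ≤ N - 1`. Positivity provides
      -- the `S`-neighbour on which the upper bound in `admissible` rests.
      S-degree-positive : ∀ u → 0ℤ < x u
      S-degree-positive u = *-cancelˡ-<-nonNeg (+ 10) (suc[i]≤j⇒i<j
        (≤-slack _ (slack (dense u) +⁺ nonneg 5 *⁺ slack (i<j⇒suc[i]≤j (degree<order G u))
                     +⁺ nonneg m +⁺ nonneg 3)
          (identity (+ m) (x u) (y u))))
        where
        identity : ∀ m x y → + 10 * x - (1ℤ + + 10 * 0ℤ) ≡
          + 10 * x + + 5 * y - (+ 6 * (1ℤ + m) - + 2) + + 5 * (1ℤ + m - (1ℤ + y)) + m + + 3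
        identity = solve-∀

      -- For an `S`-neighbour `v` of `u`, `y u ≤ N - x v` and `x u ≤ N - y v`. Weighting these by 10
      -- and 5 makes `10 x v + 5 y v` appear, which is at least `6 N - 2` by density at `v`.
      admissible : ∀ u → Admissible N (x u) (y u)
      admissible u = dense u , upper (S-neighbour S u (S-degree-positive u)) , S-degree≤degree S u , degree<order G u
        where
        identity : ∀ N x y x′ y′ → + 9 * N + + 2 - (+ 5 * x + + 10 * y) ≡
          + 10 * (N - (y + x′)) + + 5 * (N - (y′ + x)) + (+ 10 * x′ + + 5 * y′ - (+ 6 * N - + 2))
        identity = solve-∀
        upper : (∃ λ v → mem S u v ≡ true) → + 5 * x u + + 10 * y u ≤ + 9 * N + + 2
        upper (v , uv) = ≤-slack _
          (nonneg 10 *⁺ slack (degree-sum-bound S ti uv)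
            +⁺ nonneg 5 *⁺ slack (degree-sum-bound S ti (trans (memSym S v u) uv))
            +⁺ slack (dense v))
          (identity N (x u) (y u) (x v) (y v))

      dense-cut : ∃ λ c → + 5 * (∑∑ (M S) + ∑∑ (Mono G c)) ≤ + 3 * (N * N)
      dense-cut with (q , b , k) , valid , bounded ← weights (suc m) =
        average-cut q b k valid λ u → bounded (<⇒≤ (S-degree-positive u)) (admissible u)

  -- Deleting a vertex, and the induction.

  delete : ∀ {n} → Graph (suc n) → Fin (suc n) → Graph n
  delete G u .adj i j = adj G (punchIn u i) (punchIn u j)
  delete G u .Graph.sym i j = Graph.sym G (punchIn u i) (punchIn u j)
  delete G u .irrefl i = irrefl G (punchIn u i)

  restrict : ∀ {n} {G : Graph (suc n)} → EdgeSet G → ∀ u → EdgeSet (delete G u)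
  restrict S u .mem i j = mem S (punchIn u i) (punchIn u j)
  restrict S u .memSym i j = memSym S (punchIn u i) (punchIn u j)
  restrict S u .sub i j = sub S (punchIn u i) (punchIn u j)

  -- One of the two colours occurs on at most half of the neighbours of `u`. Giving it to `u`
  -- creates at most `degree G u / 2` monochromatic edges, each counted as two ordered pairs.
  extend : ∀ {n} (G : Graph (suc n)) u (c : Fin n → Bool) → ∃ λ c⁺ →
    ∑∑ (Mono G c⁺) ≤ ∑∑ (Mono (delete G u) c) + degree G u
  extend {n} G u c = c⁺ , (begin
    ∑∑ (Mono G c⁺)
      ≡⟨ ∑∑-remove (Mono G c⁺) (M-symmetric (monochromatic-edges G c⁺)) (M-hollow (monochromatic-edges G c⁺)) u ⟩
    ∑∑ (λ i j → Mono G c⁺ (punchIn u i) (punchIn u j)) + + 2 * ∑ (λ j → Mono G c⁺ u (punchIn u j))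
      ≡⟨ cong₂ (λ p r → p + + 2 * r)
           (∑∑-cong λ i j → cong₂ (λ b b′ → ⟦ adj G (punchIn u i) (punchIn u j) ∧ not (b xor b′) ⟧)
             (insertAt-punchIn c u best i) (insertAt-punchIn c u best j))
           (∑-cong λ j → cong₂ (λ b b′ → ⟦ adj G u (punchIn u j) ∧ not (b xor b′) ⟧)
             (insertAt-lookup c u best) (insertAt-punchIn c u best j)) ⟩
    ∑∑ (Mono (delete G u) c) + + 2 * cost best
      ≤⟨ +-monoʳ-≤ (∑∑ (Mono (delete G u) c)) best-cost ⟩
    ∑∑ (Mono (delete G u) c) + degree G u ∎)
    where
    open ≤-Reasoning
    cost : Bool → ℤ
    cost b = ∑ λ j → ⟦ adj G u (punchIn u j) ∧ not (b xor c j) ⟧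
    split : ∀ e b → ⟦ e ∧ not (true xor b) ⟧ + ⟦ e ∧ not (false xor b) ⟧ ≡ ⟦ e ⟧
    split false b     = refl
    split true  false = refl
    split true  true  = refl
    cost-sum : cost true + cost false ≡ degree G u
    cost-sum = trans (sym (∑-distrib-+ (λ j → ⟦ adj G u (punchIn u j) ∧ not (true xor c j) ⟧) _))
      (trans (∑-cong λ j → split (adj G u (punchIn u j)) (c j)) (sym (∑-hollow (A G) (A-hollow G) u)))
    cheaper : ∃ λ b → + 2 * cost b ≤ cost true + cost false
    cheaper with ≤-total (cost true) (cost false)
    ... | inj₁ t≤f = true , ≤-slack _ (slack t≤f) (identity (cost true) (cost false))
      where
      identity : ∀ t f → t + f - + 2 * t ≡ f - t
      identity = solve-∀
    ... | inj₂ f≤t = false , ≤-slack _ (slack f≤t) (identity (cost true) (cost false))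
      where
      identity : ∀ t f → t + f - + 2 * f ≡ t - f
      identity = solve-∀
    best = proj₁ cheaper
    c⁺ = insertAt c u best
    best-cost : + 2 * cost best ≤ degree G u
    best-cost = subst (+ 2 * cost best ≤_) cost-sum (proj₂ cheaper)

  -- Both double sums run over ordered pairs and count each edge twice, so the factor 5 stands for
  -- 10 per edge.
  cut : ∀ {n} {G : Graph n} (S : EdgeSet G) → TriangleIndependent S → ∃ λ c →
    + 5 * (∑∑ (M S) + ∑∑ (Mono G c)) ≤ + 3 * (+ n * + n)
  cut {zero} S ti = (λ ()) , ≤-refl
  -- The threshold is `3 N² - 3 (N - 1)² = 6 N - 3`, the growth of the right-hand side. Restoring
  -- `u` adds `2 x` ordered pairs of `S` and at most `y` monochromatic ones, which costs
  -- `10 x + 5 y`.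
  cut {suc n} {G} S ti with any? (λ u → + 10 * S-degree S u + + 5 * degree G u ≤? + 6 * + suc n - + 3)
  ... | no ¬sparse = Averaging.dense-cut S ti λ u →
    -- Over the integers, exceeding `6 N - 3` means reaching `6 N - 2`.
    subst (_≤ + 10 * S-degree S u + + 5 * degree G u) (identity (+ n))
      (i<j⇒suc[i]≤j (≰⇒> λ sparse → ¬sparse (u , sparse)))
    where
    identity : ∀ n → 1ℤ + (+ 6 * (1ℤ + n) - + 3) ≡ + 6 * (1ℤ + n) - + 2
    identity = solve-∀
  ... | yes (u , sparse) =
    let c , c-good = cut (restrict S u) ti′
        c⁺ , c⁺-good = extend G u c
    in c⁺ , ≤-slack _ (slack c-good +⁺ nonneg 5 *⁺ slack c⁺-good +⁺ slack sparse)
      (trans (cong (λ z → + 3 * (+ suc n * + suc n) - + 5 * (z + ∑∑ (Mono G c⁺))) removed)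
        (identity (+ n) (∑∑ (M (restrict S u))) (∑∑ (Mono (delete G u) c))
          (∑∑ (Mono G c⁺)) (S-degree S u) (degree G u)))
    where
    ti′ : TriangleIndependent (restrict S u)
    ti′ i j k = ti (punchIn u i) (punchIn u j) (punchIn u k)
    removed : ∑∑ (M S) ≡ ∑∑ (M (restrict S u)) + + 2 * S-degree S u
    removed = trans (∑∑-remove (M S) (M-symmetric S) (M-hollow S) u)
      (cong (λ z → ∑∑ (M (restrict S u)) + + 2 * z) (sym (∑-hollow (M S) (M-hollow S) u)))
    identity : ∀ n X m m⁺ x y →
      + 3 * ((1ℤ + n) * (1ℤ + n)) - + 5 * (X + + 2 * x + m⁺) ≡
      + 3 * (n * n) - + 5 * (X + m) + + 5 * (m + y - m⁺) + (+ 6 * (1ℤ + n) - + 3 - (+ 10 * x + + 5 * y))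
    identity = solve-∀


  -- Return from ordered pairs to edge counts in the natural numbers.

  size-cut : ∀ {n} {G : Graph n} (S : EdgeSet G) → TriangleIndependent S → ∃ λ c →
    10 ℕ.* (size S ℕ.+ size (monochromatic-edges G c)) ℕ.≤ 3 ℕ.* (n ℕ.* n)
  size-cut {n} {G} S independent =
    let c , c-good = cut S independent
        D = monochromatic-edges G c
    in c , drop‿+≤+ (subst₂ _≤_ (lhs (size S) (size D) (double-size S) (double-size D)) rhs c-good)
    where
    identity : ∀ p r → + 5 * (+ 2 * p + + 2 * r) ≡ + 10 * (p + r)
    identity = solve-∀
    lhs : ∀ s d {X Y} → + 2 * + s ≡ X → + 2 * + d ≡ Y → + 5 * (X + Y) ≡ + (10 ℕ.* (s ℕ.+ d))
    lhs s d refl refl = trans (identity (+ s) (+ d)) (sym (pos-* 10 (s ℕ.+ d)))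
    rhs : + 3 * (+ n * + n) ≡ + (3 ℕ.* (n ℕ.* n))
    rhs = trans (cong (+ 3 *_) (sym (pos-* n n))) (sym (pos-* 3 (n ℕ.* n)))

open import Data.Nat using (_+_; _*_; _≤_)

theorem3p5 : ∀ (n : ℕ) (G : Graph n) (a t : ℕ) → IsAlpha1 G a → IsTauB G t →
    10 * (a + t) ≤ 3 * (n * n)
theorem3p5 n G a t ((S , independent , refl) , _) (_ , t-minimal) =
  let c , bound = size-cut S independent
      minimal = t-minimal (monochromatic-edges G c) (monochromatic-edges-bipartite G c)
  in ℕ.≤-trans (ℕ.*-monoʳ-≤ 10 (ℕ.+-monoʳ-≤ (size S) minimal)) bound
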